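{- Let $D$ be any orientation of a $7$-cycle (i.e.\ $D$ is isomorphic to one of $D_1,\dots,D_{10}$) and let $v\geq 7$ be an integer. There exists a $D$-decomposition of $K^*_v$ if and only if $v\equiv 0$ or $1 \pmod 7$.
   Context: $K^*_v$ denotes the complete symmetric digraph of order $v$: it has $v$ vertices and contains both arcs $(x,y)$ and $(y,x)$ for every pair of distinct vertices $x,y$. A $D$-decomposition of a digraph $K$ is a set of subdigraphs of $K$, each isomorphic to $D$, such that every arc of $K$ lies in exactly one of them. For distinct vertices $v_0,\dots,v_6$, the digraphs $D_i[v_0,v_1,\dots,v_6]$ ($i\in[1,10]$) all have vertex set $\{v_0,\dots,v_6\}$ and the following arc sets: $D_1$: $(v_1,v_0),(v_1,v_2),(v_2,v_3),(v_3,v_4),(v_4,v_5),(v_5,v_6),(v_6,v_0)$; $D_2$: $(v_1,v_0),(v_2,v_1),(v_2,v_3),(v_3,v_4),(v_4,v_5),(v_5,v_6),(v_6,v_0)$; $D_3$: $(v_1,v_0),(v_1,v_2),(v_3,v_2),(v_3,v_4),(v_4,v_5),(v_5,v_6),(v_6,v_0)$; $D_4$: $(v_1,v_0),(v_1,v_2),(v_2,v_3),(v_4,v_3),(v_4,v_5),(v_5,v_6),(v_6,v_0)$; $D_5$: $(v_1,v_0),(v_2,v_1),(v_3,v_2),(v_3,v_4),(v_4,v_5),(v_5,v_6),(v_6,v_0)$; $D_6$: $(v_1,v_0),(v_2,v_1),(v_2,v_3),(v_3,v_4),(v_5,v_4),(v_5,v_6),(v_6,v_0)$; $D_7$: $(v_1,v_0),(v_1,v_2),(v_3,v_2),(v_3,v_4),(v_4,v_5),(v_6,v_5),(v_6,v_0)$;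 $D_8$: $(v_1,v_0),(v_2,v_1),(v_2,v_3),(v_4,v_3),(v_4,v_5),(v_5,v_6),(v_6,v_0)$; $D_9$: $(v_1,v_0),(v_2,v_1),(v_2,v_3),(v_3,v_4),(v_4,v_5),(v_6,v_5),(v_6,v_0)$; $D_{10}$: $(v_0,v_1),(v_1,v_2),(v_2,v_3),(v_3,v_4),(v_4,v_5),(v_5,v_6),(v_6,v_0)$. $D_i$ also denotes the isomorphism type of $D_i[v_0,\dots,v_6]$; these ten digraphs are, up to isomorphism, all orientations of a $7$-cycle. -}

module Defs where

open import Data.Bool using (Bool; T)
open import Data.Fin using (Fin)
open import Data.Fin.Patterns using (0F; 1F; 2F; 3F; 4F; 5F; 6F)
open import Data.List using (List; []; _∷_)
open import Data.List.Membership.Propositional using (_∈_)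
open import Data.List.Relation.Unary.Any using (Any)
open import Data.Nat using (ℕ)
open import Data.Product using (Σ; ∃!; _×_; _,_; proj₁)
open import Function.Bundles using (_↔_; _⇔_; Inverse)
open import Relation.Binary.PropositionalEquality using (_≡_; _≢_)

-- Only the inhabitation of Arc x y matters: there are no parallel arcs.
record Digraph : Set₁ where
  field
    Vertex : Set
    Arc    : Vertex → Vertex → Set

open Digraph public

record _≅_ (D E : Digraph) : Set where
  field
    vertices : Vertex D ↔ Vertex E
    arcs     : ∀ x y → Arc D x y ⇔ Arc E (Inverse.to vertices x) (Inverse.to vertices y)

infix 4 _≅_

-- Subsets are Bool-valued so that membership proofs are unique, and hence
-- the vertex type of ⌞ B ⌟ below has the expected number of elements.
record Subdigraph (K : Digraph) : Set where
  field
    vertex? : Vertex K → Bool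
    arc?    : Vertex K → Vertex K → Bool
    arc⇒arc : ∀ {x y} → T (arc? x y) → Arc K x y
    source  : ∀ {x y} → T (arc? x y) → T (vertex? x)
    target  : ∀ {x y} → T (arc? x y) → T (vertex? y)

module _ {K : Digraph} where
  open Subdigraph

  ⌞_⌟ : Subdigraph K → Digraph
  Vertex ⌞ B ⌟     = Σ (Vertex K) (λ x → T (vertex? B x))
  Arc    ⌞ B ⌟ x y = T (arc? B (proj₁ x) (proj₁ y))

  _≈_ : Subdigraph K → Subdigraph K → Set
  B ≈ C = (∀ x → vertex? B x ≡ vertex? C x) × (∀ x y → arc? B x y ≡ arc? C x y)

  infix 4 _≈_

-- The set of subdigraphs is given by a finite enumeration without repetition.
record Decomposition (D K : Digraph) : Set where
  field
    size       : ℕ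
    block      : Fin size → Subdigraph K
    distinct   : ∀ {i j} → block i ≈ block j → i ≡ j
    isomorphic : ∀ i → ⌞ block i ⌟ ≅ D
    exactlyOne : ∀ x y → Arc K x y → ∃! _≡_ (λ i → T (Subdigraph.arc? (block i) x y))

K* : ℕ → Digraph
Vertex (K* v)     = Fin v
Arc    (K* v) x y = x ≢ y

fromArcs : ∀ {n} → List (Fin n × Fin n) → Digraph
Vertex (fromArcs {n} as)     = Fin n
Arc    (fromArcs     as) x y = (x , y) ∈ as

D₁ D₂ D₃ D₄ D₅ D₆ D₇ D₈ D₉ D₁₀ : Digraph
D₁  = fromArcs {7} ((1F , 0F) ∷ (1F , 2F) ∷ (2F , 3F) ∷ (3F , 4F) ∷ (4F , 5F) ∷ (5F , 6F) ∷ (6F , 0F) ∷ [])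
D₂  = fromArcs {7} ((1F , 0F) ∷ (2F , 1F) ∷ (2F , 3F) ∷ (3F , 4F) ∷ (4F , 5F) ∷ (5F , 6F) ∷ (6F , 0F) ∷ [])
D₃  = fromArcs {7} ((1F , 0F) ∷ (1F , 2F) ∷ (3F , 2F) ∷ (3F , 4F) ∷ (4F , 5F) ∷ (5F , 6F) ∷ (6F , 0F) ∷ [])
D₄  = fromArcs {7} ((1F , 0F) ∷ (1F , 2F) ∷ (2F , 3F) ∷ (4F , 3F) ∷ (4F , 5F) ∷ (5F , 6F) ∷ (6F , 0F) ∷ [])
D₅  = fromArcs {7} ((1F , 0F) ∷ (2F , 1F) ∷ (3F , 2F) ∷ (3F , 4F) ∷ (4F , 5F) ∷ (5F , 6F) ∷ (6F , 0F) ∷ [])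
D₆  = fromArcs {7} ((1F , 0F) ∷ (2F , 1F) ∷ (2F , 3F) ∷ (3F , 4F) ∷ (5F , 4F) ∷ (5F , 6F) ∷ (6F , 0F) ∷ [])
D₇  = fromArcs {7} ((1F , 0F) ∷ (1F , 2F) ∷ (3F , 2F) ∷ (3F , 4F) ∷ (4F , 5F) ∷ (6F , 5F) ∷ (6F , 0F) ∷ [])
D₈  = fromArcs {7} ((1F , 0F) ∷ (2F , 1F) ∷ (2F , 3F) ∷ (4F , 3F) ∷ (4F , 5F) ∷ (5F , 6F) ∷ (6F , 0F) ∷ [])
D₉  = fromArcs {7} ((1F , 0F) ∷ (2F , 1F) ∷ (2F , 3F) ∷ (3F , 4F) ∷ (4F , 5F) ∷ (6F , 5F) ∷ (6F , 0F) ∷ [])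
D₁₀ = fromArcs {7} ((0F , 1F) ∷ (1F , 2F) ∷ (2F , 3F) ∷ (3F , 4F) ∷ (4F , 5F) ∷ (5F , 6F) ∷ (6F , 0F) ∷ [])

orientations : List Digraph
orientations = D₁ ∷ D₂ ∷ D₃ ∷ D₄ ∷ D₅ ∷ D₆ ∷ D₇ ∷ D₈ ∷ D₉ ∷ D₁₀ ∷ []

IsOrientationOf7Cycle : Digraph → Set₁
IsOrientationOf7Cycle D = Any (D ≅_) orientations

{-# OPTIONS --safe #-}
module Submission where

-- Necessity: the blocks partition the v (v - 1) arcs into sevens, so 7 divides v or v - 1.
--
-- Sufficiency: write v = 7k or v = 7k + 1. For k ≤ 2 the blocks are listed, as orbits of a few starters.
-- For k ≥ 3 split the vertices into k groups indexed by Z₇ (plus one extra point if v = 7k + 1) and fill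
-- each group (with the extra point) by the case k = 1. For the arcs between groups, take an idempotent
-- quasigroup on the groups: for distinct groups a, b, lay a closed walk of length 7 on the groups
-- a, b, a ∙ b so that its seven arcs realise the seven differences in Z₇, and translate it by Z₇.
-- An arc from (x , p) to (y , q) then determines the position with difference q - p, and as two entries
-- of a quasigroup triple determine the third, it also determines a and b.
-- Only "at least once" has to be verified, since the number of blocks is exactly v (v - 1) / 7.

open import Data.Bool using (T; if_then_else_)
open import Data.Bool.Properties using (T-irrelevant)
open import Data.Fin using (Fin; zero; suc; toℕ; punchIn; punchOut; combine; remQuot)
open import Data.Fin.Patterns using (0F; 1F; 2F; 3F; 4F; 5F; 6F)
open import Data.Fin.Properties using (_≟_; all?; any?; *↔×; +↔⊎; injective⇒≤; punchIn-injective; punchOut-injective; punchIn-punchOut; punchInᵢ≢i; remQuot-combine; combine-remQuot; suc-injective; toℕ-fromℕ<; toℕ-injective; toℕ<n)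
open import Data.List.Membership.Propositional using (_∈_)
open import Data.List.Relation.Unary.All using (All; []; _∷_; lookupAny)
open import Data.Nat using (ℕ; zero; suc; _+_; _*_; _≤_; _<ᵇ_; _/_; _%_; NonZero; z≤n; s≤s)
open import Data.Nat.Divisibility using (divides; n∣m⇒m%n≡0)
open import Data.Nat.DivMod using (_mod_; m≡m%n+[m/n]*n; [m+kn]%n≡m%n; m<n⇒m%n≡m; m%n<n; m%n%n≡m%n; %-distribˡ-+; %-distribˡ-*)
open import Data.Nat.Primality using (euclidsLemma; prime?)
open import Data.Nat.Properties using (≤-refl; ≤-reflexive; ≤-trans; ≤-antisym; <⇒≱; 1+n≰n; +-comm; +-identityʳ)
open import Data.Nat.Solver using (module +-*-Solver)
open import Data.Product using (∃; ∃₂; _×_; _,_; proj₁; proj₂)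
open import Data.Product.Function.NonDependent.Propositional using (_×-↔_)
open import Data.Product.Properties using (,-injectiveˡ; ,-injectiveʳ; ≡-dec)
open import Data.Sum using (_⊎_; inj₁; inj₂; [_,_]′)
open import Data.Sum.Function.Propositional using (_⊎-↔_)
open import Data.Sum.Properties using (inj₂-injective)
open import Data.Vec using (Vec; []; _∷_; _++_; lookup; toList; map; concat; tabulate)
open import Data.Vec.Membership.Propositional.Properties using (∈-lookup; ∈-toList⁺; ∈-toList⁻)
import Data.Vec.Relation.Unary.Any as VecAny
import Data.Vec.Relation.Unary.Any.Properties as VecAnyₚ
open import Function using (Injective; Injection; _∘_; id; case_of_)
open import Function.Bundles using (_↔_; _⇔_; Inverse; Equivalence; mk↔ₛ′; mk⇔)
open import Function.Construct.Composition using (_⇔-∘_)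
open import Function.Construct.Symmetry using (⇔-sym)
open import Function.Properties.Inverse using (↔-refl; ↔-sym; ↔-trans; ↔⇒↣)
open import Relation.Binary.PropositionalEquality using (_≡_; _≢_; refl; sym; trans; cong; cong₂; subst; subst₂)
open import Relation.Nullary using (Dec; yes; no; contradiction; ¬?; _×-dec_; _⊎-dec_; _→-dec_)
open import Relation.Nullary.Decidable using (True; toWitness; fromWitness; ⌊_⌋)
open import Defs

open +-*-Solver using (solve; _:=_; _:+_; _:*_; con)

-- Coverings and the counting of their arcs.

-- Pigeonhole: if `y` were missed, deleting it from the codomain would leave an injection of `Fin n`
-- into a set with fewer than `n` elements.
injective∧≤⇒surjective : ∀ {m n} {f : Fin n → Fin m} → Injective _≡_ _≡_ f → m ≤ n → ∀ y → ∃ λ x → f x ≡ y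
injective∧≤⇒surjective {suc m} {n} {f} f-injective m<n y with any? (λ x → f x ≟ y)
... | yes hit = hit
... | no miss = contradiction (≤-trans m<n (injective⇒≤ avoid-injective)) 1+n≰n
  where
  y≢f : ∀ x → y ≢ f x
  y≢f x eq = miss (x , sym eq)
  avoid-injective : Injective _≡_ _≡_ (λ x → punchOut (y≢f x))
  avoid-injective {a} {b} eq = f-injective (punchOut-injective (y≢f a) (y≢f b) eq)

Arcs : Set
Arcs = Vec (Fin 7 × Fin 7) 7

tail head : Arcs → Fin 7 → Fin 7
tail as j = proj₁ (lookup as j)
head as j = proj₂ (lookup as j)

⟦_⟧ : Arcs → Digraph
⟦ as ⟧ = fromArcs (toList as)

∈⇒lookup : ∀ (as : Arcs) {a} → a ∈ toList as → ∃ λ j → lookup as j ≡ a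
∈⇒lookup as a∈ = VecAny.index a∈as , sym (VecAnyₚ.lookup-index a∈as)
  where a∈as = ∈-toList⁻ a∈

lookup⇒∈ : ∀ (as : Arcs) j → lookup as j ∈ toList as
lookup⇒∈ as j = ∈-toList⁺ (∈-lookup j as)

-- Blocks are placements of the seven vertices, and arcs are only required to be hit at least once.
-- Arbitrary index and vertex types let constructions use products and sums; `relabel` moves the
-- result to `Fin`.
record Covering (as : Arcs) (I V : Set) : Set where
  field
    block     : I → Fin 7 → V
    injective : ∀ i {j k} → block i j ≡ block i k → j ≡ k

  blockArc : I → Fin 7 → V × V
  blockArc i j = block i (tail as j) , block i (head as j)

  field
    covers : ∀ {x y} → x ≢ y → ∃₂ λ i j → blockArc i j ≡ (x , y)

relabel : ∀ {as I J V W} → I ↔ J → V ↔ W → Covering as I V → Covering as J W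
relabel {as} I↔J V↔W C = record
  { block     = λ j → g.to ∘ block (f.from j)
  ; injective = λ j eq → injective (f.from j) (Injection.injective (↔⇒↣ V↔W) eq)
  ; covers    = λ x≢y → case covers (x≢y ∘ Injection.injective (↔⇒↣ (↔-sym V↔W))) of λ where
      (i , j , eq) → f.to i , j ,
        cong₂ _,_ (onto i (tail as j) (cong proj₁ eq)) (onto i (head as j) (cong proj₂ eq))
  }
  where
  open Covering C
  module f = Inverse I↔J
  module g = Inverse V↔W
  onto : ∀ i j {x} → block i j ≡ g.from x → g.to (block (f.from (f.to i)) j) ≡ x
  onto i j {x} eq = trans (cong g.to (trans (cong (λ k → block k j) (f.strictlyInverseʳ i)) eq)) (g.strictlyInverseˡ x)

-- Codes the ordered pairs of distinct points without repetition, which makes their number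
-- `suc w * w` visible in the type.
punch : ∀ {w} → Fin (suc w) × Fin w → Fin (suc w) × Fin (suc w)
punch (x , d) = x , punchIn x d

punch-injective : ∀ {w} → Injective _≡_ _≡_ (punch {w})
punch-injective {w} {x , d} {y , e} eq with refl ← ,-injectiveˡ eq =
  cong (x ,_) (punchIn-injective x d e (,-injectiveʳ eq))

offDiagonal : ∀ {w} → Fin (suc w * w) → Fin (suc w) × Fin (suc w)
offDiagonal {w} c = punch (remQuot {suc w} w c)

offDiagonal-injective : ∀ {w} → Injective _≡_ _≡_ (offDiagonal {w})
offDiagonal-injective {w} = Injection.injective (↔⇒↣ (*↔× {suc w} {w})) ∘ punch-injective

offDiagonal-≢ : ∀ {w} (c : Fin (suc w * w)) → proj₁ (offDiagonal {w} c) ≢ proj₂ (offDiagonal {w} c)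
offDiagonal-≢ {w} c = punchInᵢ≢i _ (proj₂ (remQuot {suc w} w c)) ∘ sym

offDiagonal-onto : ∀ {w} {x y : Fin (suc w)} → x ≢ y → ∃ λ c → offDiagonal {w} c ≡ (x , y)
offDiagonal-onto {w} {x} {y} x≢y = combine x (punchOut x≢y) ,
  trans (cong punch (remQuot-combine x (punchOut x≢y))) (cong (x ,_) (punchIn-punchOut x≢y))

module Slots {as m w} (C : Covering as (Fin m) (Fin (suc w))) where
  open Covering C

  -- A slot is a block together with one of its seven arcs. `slot` below chooses for each arc of the
  -- complete digraph a slot carrying it.
  slotArc : Fin (m * 7) → Fin (suc w) × Fin (suc w)
  slotArc s = blockArc (proj₁ (remQuot {m} 7 s)) (proj₂ (remQuot {m} 7 s))

  slotArc-combine : ∀ i j → slotArc (combine i j) ≡ blockArc i j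
  slotArc-combine i j = cong (λ p → blockArc (proj₁ p) (proj₂ p)) (remQuot-combine i j)

  slot : ∀ c → ∃ λ s → slotArc s ≡ offDiagonal {w} c
  slot c with i , j , eq ← covers (offDiagonal-≢ c) = combine i j , trans (slotArc-combine i j) eq

  slot-injective : Injective _≡_ _≡_ (proj₁ ∘ slot)
  slot-injective {c} {d} eq = offDiagonal-injective
    (trans (sym (proj₂ (slot c))) (trans (cong slotArc eq) (proj₂ (slot d))))

  -- slot is then an injection between sets of the same size, hence onto.
  slotArc-injective : m * 7 ≤ suc w * w → Injective _≡_ _≡_ slotArc
  slotArc-injective small {s} {t} eq
    with c , refl ← injective∧≤⇒surjective slot-injective small s
       | d , refl ← injective∧≤⇒surjective slot-injective small t
    = cong (proj₁ ∘ slot) (offDiagonal-injective (trans (sym (proj₂ (slot c))) (trans eq (proj₂ (slot d)))))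

  blockArc-unique : m * 7 ≤ suc w * w → ∀ {i j i′ j′} → blockArc i j ≡ blockArc i′ j′ → i ≡ i′
  blockArc-unique small {i} {j} {i′} {j′} eq = trans (cong proj₁ (sym (remQuot-combine i j))) (trans
    (cong (proj₁ ∘ remQuot {m} 7) (slotArc-injective small
      (trans (slotArc-combine i j) (trans eq (sym (slotArc-combine i′ j′))))))
    (cong proj₁ (remQuot-combine i′ j′)))

-- Isomorphism of digraphs.

≅-sym : ∀ {D E} → D ≅ E → E ≅ D
≅-sym {D} {E} D≅E = record
  { vertices = ↔-sym vertices
  ; arcs     = λ x y → ⇔-sym (subst₂ (λ x′ y′ → Arc D (from x) (from y) ⇔ Arc E x′ y′)
                 (strictlyInverseˡ x) (strictlyInverseˡ y) (arcs (from x) (from y)))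
  }
  where
  open _≅_ D≅E
  open Inverse vertices

≅-trans : ∀ {D E F} → D ≅ E → E ≅ F → D ≅ F
≅-trans D≅E E≅F = record
  { vertices = ↔-trans (_≅_.vertices D≅E) (_≅_.vertices E≅F)
  ; arcs     = λ x y → _≅_.arcs E≅F _ _ ⇔-∘ _≅_.arcs D≅E x y
  }

Decomposition-resp-≅ : ∀ {D E K} → D ≅ E → Decomposition D K → Decomposition E K
Decomposition-resp-≅ D≅E X = record
  { size       = size
  ; block      = block
  ; distinct   = distinct
  ; isomorphic = λ i → ≅-trans (isomorphic i) D≅E
  ; exactlyOne = exactlyOne
  }
  where open Decomposition X

Loopless : Arcs → Set
Loopless as = ∀ j → tail as j ≢ head as j

-- From coverings to decompositions

module _ {as m w} (loopless : Loopless as) (C : Covering as (Fin m) (Fin (suc w))) (small : m * 7 ≤ suc w * w) where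
  open Covering C
  open Slots C

  private
    vertexDec : ∀ i x → Dec (∃ λ j → block i j ≡ x)
    vertexDec i x = any? (λ j → block i j ≟ x)

    arcDec : ∀ i x y → Dec (∃ λ j → blockArc i j ≡ (x , y))
    arcDec i x y = any? (λ j → ≡-dec _≟_ _≟_ (blockArc i j) (x , y))

    subdigraph : Fin m → Subdigraph (K* (suc w))
    subdigraph i = record
      { vertex? = λ x → ⌊ vertexDec i x ⌋
      ; arc?    = λ x y → ⌊ arcDec i x y ⌋
      ; arc⇒arc = λ t x≡y → case toWitness t of λ where
          (j , eq) → loopless j (injective i (trans (cong proj₁ eq) (trans x≡y (sym (cong proj₂ eq)))))
      ; source  = λ t → case toWitness t of λ where
          (j , eq) → fromWitness (tail as j , cong proj₁ eq)
      ; target  = λ t → case toWitness t of λ where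
          (j , eq) → fromWitness (head as j , cong proj₂ eq)
      }

    vertices↔ : ∀ i → Vertex ⌞ subdigraph i ⌟ ↔ Fin 7
    vertices↔ i = mk↔ₛ′ to from to∘from from∘to
      where
      to : Vertex ⌞ subdigraph i ⌟ → Fin 7
      to (x , t) = proj₁ (toWitness t)
      from : Fin 7 → Vertex ⌞ subdigraph i ⌟
      from j = block i j , fromWitness (j , refl)
      to∘from : ∀ j → to (from j) ≡ j
      -- The search inside `vertexDec` may find any preimage of `block i j`; injectivity identifies
      -- it with `j`.
      to∘from j = injective i (proj₂ (toWitness (proj₂ (from j))))
      from∘to : ∀ x → from (to x) ≡ x
      from∘to (x , t) with toWitness t
      ... | j , refl = cong (x ,_) (T-irrelevant _ _)

    isomorphic : ∀ i → ⌞ subdigraph i ⌟ ≅ ⟦ as ⟧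
    isomorphic i = record
      { vertices = vertices↔ i
      ; arcs     = λ x y → mk⇔ (to⇒ x y) (⇐to x y)
      }
      where
      open Inverse (vertices↔ i)
      index : ∀ x → block i (to x) ≡ proj₁ x
      index (x , t) = proj₂ (toWitness t)
      to⇒ : ∀ x y → Arc ⌞ subdigraph i ⌟ x y → (to x , to y) ∈ toList as
      to⇒ x y t with j , eq ← toWitness t = subst (_∈ toList as)
        (cong₂ _,_ (injective i (trans (cong proj₁ eq) (sym (index x))))
                   (injective i (trans (cong proj₂ eq) (sym (index y)))))
        (lookup⇒∈ as j)
      ⇐to : ∀ x y → (to x , to y) ∈ toList as → Arc ⌞ subdigraph i ⌟ x y
      ⇐to x y a∈ with j , eq ← ∈⇒lookup as a∈ = fromWitness (j ,
        cong₂ _,_ (trans (cong (block i ∘ proj₁) eq) (index x)) (trans (cong (block i ∘ proj₂) eq) (index y)))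

  decomposition : Decomposition ⟦ as ⟧ (K* (suc w))
  decomposition = record
    { size       = m
    ; block      = subdigraph
    -- Equal blocks share the arc in position 0, and an arc lies in only one block.
    ; distinct   = λ { {i} {i′} (_ , same) →
        let j , eq = toWitness (subst T (same _ _) (fromWitness {a? = arcDec i _ _} (0F , refl)))
        in blockArc-unique small (sym eq) }
    ; isomorphic = isomorphic
    ; exactlyOne = λ x y x≢y → case covers x≢y of λ where
        (i , j , eq) → i , fromWitness (j , eq) , λ {_} t → blockArc-unique small (trans eq (sym (proj₂ (toWitness t))))
    }

-- From decompositions to counting

module _ {as : Arcs} {w} (arcs-injective : ∀ {j k} → lookup as j ≡ lookup as k → j ≡ k)
         (X : Decomposition ⟦ as ⟧ (K* (suc w))) where
  private
    module X = Decomposition X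
    module iso i = Inverse (_≅_.vertices (X.isomorphic i))

    block-vertex : ∀ i → Fin 7 → Fin (suc w)
    block-vertex i j = proj₁ (iso.from i j)

    from-injective : ∀ i {j k} → block-vertex i j ≡ block-vertex i k → j ≡ k
    from-injective i {j} {k} eq = trans (sym (iso.strictlyInverseˡ i j))
      (trans (cong (iso.to i) (Σ-≡ (iso.from i j) (iso.from i k) eq)) (iso.strictlyInverseˡ i k))
      where
      Σ-≡ : ∀ (p q : Vertex ⌞ X.block i ⌟) → proj₁ p ≡ proj₁ q → p ≡ q
      Σ-≡ (x , s) (x , t) refl = cong (x ,_) (T-irrelevant s t)

    asCovering : Covering as (Fin X.size) (Fin (suc w))
    asCovering = record
      { block     = block-vertex
      ; injective = from-injective
      ; covers    = λ {x} {y} x≢y →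
          let i , t , _ = X.exactlyOne x y x≢y
              B = X.block i
              x′ = x , Subdigraph.source B t
              y′ = y , Subdigraph.target B t
              j , eq = ∈⇒lookup as (Equivalence.to (_≅_.arcs (X.isomorphic i) x′ y′) t)
          in i , j , cong₂ _,_
               (cong proj₁ (trans (cong (iso.from i ∘ proj₁) eq) (iso.strictlyInverseʳ i x′)))
               (cong proj₁ (trans (cong (iso.from i ∘ proj₂) eq) (iso.strictlyInverseʳ i y′)))
      }

    open Covering asCovering
    open Slots asCovering

    blockArc-∈ : ∀ i j → T (Subdigraph.arc? (X.block i) (proj₁ (blockArc i j)) (proj₂ (blockArc i j)))
    blockArc-∈ i j = Equivalence.from (_≅_.arcs (X.isomorphic i) _ _)
      (subst (_∈ toList as) (sym (cong₂ _,_ (iso.strictlyInverseˡ i _) (iso.strictlyInverseˡ i _))) (lookup⇒∈ as j))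

    blockArc-≢ : ∀ i j → proj₁ (blockArc i j) ≢ proj₂ (blockArc i j)
    blockArc-≢ i j = Subdigraph.arc⇒arc (X.block i) (blockArc-∈ i j)

    -- The common arc lies in both blocks, so uniqueness identifies them; within one block the
    -- vertices are distinct, so the positions carry the same listed arc.
    blockArc-injective : ∀ i i′ j j′ → blockArc i j ≡ blockArc i′ j′ → (i , j) ≡ (i′ , j′)
    blockArc-injective i i′ j j′ eq
      with _ , _ , unique ← X.exactlyOne _ _ (blockArc-≢ i j)
      with refl ← trans (sym (unique (blockArc-∈ i j)))
                        (unique (subst (λ a → T (Subdigraph.arc? (X.block i′) (proj₁ a) (proj₂ a))) (sym eq) (blockArc-∈ i′ j′)))
      = cong (i ,_) (arcs-injective (cong₂ _,_ (from-injective i (cong proj₁ eq)) (from-injective i (cong proj₂ eq))))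

    code : ∀ (s : Fin (X.size * 7)) → ∃ λ c → offDiagonal {w} c ≡ slotArc s
    code s = offDiagonal-onto (blockArc-≢ (proj₁ (remQuot {X.size} 7 s)) (proj₂ (remQuot {X.size} 7 s)))

    code-injective : Injective _≡_ _≡_ (proj₁ ∘ code)
    code-injective {s} {t} eq =
      trans (sym (combine-remQuot {X.size} 7 s)) (trans
        (cong (λ p → combine (proj₁ p) (proj₂ p)) (blockArc-injective _ _ _ _
          (trans (sym (proj₂ (code s))) (trans (cong offDiagonal eq) (proj₂ (code t))))))
        (combine-remQuot {X.size} 7 t))

  -- Double counting by injections both ways: `code` sends slots to arcs, `slot` sends arcs to
  -- slots.
  arc-count : X.size * 7 ≡ suc w * w
  arc-count = ≤-antisym (injective⇒≤ code-injective) (injective⇒≤ slot-injective)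

-- Idempotent quasigroups of every order from 3 on

record IdempotentQuasigroup (n : ℕ) : Set where
  field
    _∙_      : Fin n → Fin n → Fin n
    idem     : ∀ a → a ∙ a ≡ a
    -- These two laws keep `a`, `b` and `a ∙ b` three different groups.
    ∙≢ˡ      : ∀ {a b} → a ≢ b → a ∙ b ≢ a
    ∙≢ʳ      : ∀ {a b} → a ≢ b → a ∙ b ≢ b
    divideˡ  : ∀ a c → ∃ λ b → a ∙ b ≡ c
    divideʳ  : ∀ b c → ∃ λ a → a ∙ b ≡ c

-- Modulo an odd number 2 is invertible, and the midpoint (a + b) / 2 is an idempotent commutative
-- quasigroup operation.
module Midpoint (h : ℕ) where
  n : ℕ
  n = suc (2 * h)

  -- A record, so that both sides can be inferred from a proof.
  infix 4 _≋_
  record _≋_ (x y : ℕ) : Set where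
    constructor congruent
    field residues : x % n ≡ y % n

  open _≋_

  infixr 5 _⊙_
  _⊙_ : ∀ {x y z} → x ≋ y → y ≋ z → x ≋ z
  p ⊙ q = congruent (trans (residues p) (residues q))

  ≋⇒≡ : ∀ {a b : Fin n} → toℕ a ≋ toℕ b → a ≡ b
  ≋⇒≡ {a} {b} (congruent eq) = toℕ-injective (trans (sym (m<n⇒m%n≡m (toℕ<n a))) (trans eq (m<n⇒m%n≡m (toℕ<n b))))

  toℕ-mod : ∀ x → toℕ (x mod n) ≋ x
  toℕ-mod x = congruent (trans (cong (_% n) (toℕ-fromℕ< (m%n<n x n))) (m%n%n≡m%n x n))

  +-cong : ∀ {x y z w} → x ≋ y → z ≋ w → x + z ≋ y + w
  +-cong {x} {y} {z} {w} (congruent p) (congruent q) = congruent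
    (trans (%-distribˡ-+ x z n) (trans (cong₂ (λ d e → (d + e) % n) p q) (sym (%-distribˡ-+ y w n))))

  +-congˡ : ∀ x {y z} → y ≋ z → x + y ≋ x + z
  +-congˡ x = +-cong {x} (congruent refl)

  *-congˡ : ∀ x {y z} → y ≋ z → x * y ≋ x * z
  *-congˡ x {y} {z} (congruent eq) = congruent
    (trans (%-distribˡ-* x y n) (trans (cong (λ e → (x % n * e) % n) eq) (sym (%-distribˡ-* x z n))))

  -- Reduces a congruence to a polynomial identity for the ring solver, with the quotient `k` as
  -- explicit witness.
  multiple : ∀ x k {y} → y ≡ x + k * n → y ≋ x
  multiple x k refl = congruent ([m+kn]%n≡m%n x k n)

  mod-≡ : ∀ x {a : Fin n} → x ≋ toℕ a → x mod n ≡ a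
  mod-≡ x x≋a = ≋⇒≡ (toℕ-mod x ⊙ x≋a)

  -- 1 + h is the inverse of 2 modulo 1 + 2h.
  infixl 7 _∙_
  _∙_ : Fin n → Fin n → Fin n
  a ∙ b = (suc h * (toℕ a + toℕ b)) mod n

  -- The reflection 2c - a of `a` in `c`, which solves `a ∙ b ≡ c` for `b`. Negation is
  -- multiplication by `2 * h`, which is -1 modulo `n`.
  reflect : Fin n → Fin n → Fin n
  reflect a c = (2 * toℕ c + 2 * h * toℕ a) mod n

  ∙-idem : ∀ a → a ∙ a ≡ a
  ∙-idem a = mod-≡ (suc h * (toℕ a + toℕ a)) (multiple (toℕ a) (toℕ a)
    (solve 2 (λ h a → (con 1 :+ h) :* (a :+ a) := a :+ a :* (con 1 :+ con 2 :* h)) refl h (toℕ a)))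

  ∙-comm : ∀ a b → a ∙ b ≡ b ∙ a
  ∙-comm a b = cong (λ e → (suc h * e) mod n) (+-comm (toℕ a) (toℕ b))

  ∙-reflect : ∀ a c → a ∙ reflect a c ≡ c
  ∙-reflect a c = mod-≡ (suc h * (toℕ a + toℕ (reflect a c)))
    (*-congˡ (suc h) (+-congˡ (toℕ a) (toℕ-mod (2 * toℕ c + 2 * h * toℕ a))) ⊙
     multiple (toℕ c) (toℕ c + suc h * toℕ a)
       (solve 3 (λ h a c → (con 1 :+ h) :* (a :+ (con 2 :* c :+ con 2 :* h :* a))
         := c :+ (c :+ (con 1 :+ h) :* a) :* (con 1 :+ con 2 :* h)) refl h (toℕ a) (toℕ c)))

  reflect-∙ : ∀ a b → reflect a (a ∙ b) ≡ b
  reflect-∙ a b = mod-≡ (2 * toℕ (a ∙ b) + 2 * h * toℕ a)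
    (+-cong {w = 2 * h * toℕ a} (*-congˡ 2 (toℕ-mod (suc h * (toℕ a + toℕ b)))) (congruent refl) ⊙
     multiple (toℕ b) (2 * toℕ a + toℕ b)
       (solve 3 (λ h a b → con 2 :* ((con 1 :+ h) :* (a :+ b)) :+ con 2 :* h :* a
         := b :+ (con 2 :* a :+ b) :* (con 1 :+ con 2 :* h)) refl h (toℕ a) (toℕ b)))

  -- Otherwise `a ∙ b` and `a ∙ a` agree, and cancelling `a` by reflection gives `a ≡ b`.
  ∙≢ˡ : ∀ {a b} → a ≢ b → a ∙ b ≢ a
  ∙≢ˡ {a} {b} a≢b eq = a≢b (trans (sym (reflect-∙ a a)) (trans (cong (reflect a) (trans (∙-idem a) (sym eq))) (reflect-∙ a b)))

  ∙≢ʳ : ∀ {a b} → a ≢ b → a ∙ b ≢ b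
  ∙≢ʳ {a} {b} a≢b eq = ∙≢ˡ (a≢b ∘ sym) (trans (∙-comm b a) eq)

  odd : IdempotentQuasigroup n
  odd = record
    { _∙_     = _∙_
    ; idem    = ∙-idem
    ; ∙≢ˡ     = ∙≢ˡ
    ; ∙≢ʳ     = ∙≢ʳ
    ; divideˡ = λ a c → reflect a c , ∙-reflect a c
    ; divideʳ = λ b c → reflect b c , trans (∙-comm _ b) (∙-reflect b c)
    }

  next previous : Fin n → Fin n
  next a     = (1 + toℕ a) mod n
  previous a = (2 * h + toℕ a) mod n

  next-previous : ∀ a → next (previous a) ≡ a
  next-previous a = mod-≡ (1 + toℕ (previous a)) (+-congˡ 1 (toℕ-mod (2 * h + toℕ a)) ⊙ multiple (toℕ a) 1
    (solve 2 (λ h a → con 1 :+ (con 2 :* h :+ a) := a :+ con 1 :* (con 1 :+ con 2 :* h)) refl h (toℕ a)))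

  previous-next : ∀ a → previous (next a) ≡ a
  previous-next a = mod-≡ (2 * h + toℕ (next a)) (+-congˡ (2 * h) (toℕ-mod (1 + toℕ a)) ⊙ multiple (toℕ a) 1
    (solve 2 (λ h a → con 2 :* h :+ (con 1 :+ a) := a :+ con 1 :* (con 1 :+ con 2 :* h)) refl h (toℕ a)))

  -- As `2 * h` is -1, `h` is -1/2. So `shift c` is c - 1/2 and its successor is c + 1/2, with
  -- midpoint `c`: the cells (a , a + 1) take every value.
  shift : Fin n → Fin n
  shift c = (toℕ c + h) mod n

  shift-midpoint : ∀ c → shift c ∙ next (shift c) ≡ c
  shift-midpoint c = mod-≡ (suc h * (toℕ (shift c) + toℕ (next (shift c))))
    (*-congˡ (suc h) (+-cong shift≋ (toℕ-mod (1 + toℕ (shift c)) ⊙ +-congˡ 1 shift≋)) ⊙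
     multiple (toℕ c) (toℕ c + suc h)
       (solve 2 (λ h c → (con 1 :+ h) :* ((c :+ h) :+ (con 1 :+ (c :+ h)))
         := c :+ (c :+ (con 1 :+ h)) :* (con 1 :+ con 2 :* h)) refl h (toℕ c)))
    where
    shift≋ : toℕ (shift c) ≋ toℕ c + h
    shift≋ = toℕ-mod (toℕ c + h)

  next-≢ : 1 ≤ h → ∀ a → a ≢ next a
  -- Matching on `1 ≤ h` makes `n` at least 2 visibly, so that `1 % n` computes to 1. The congruence
  -- 1 ≋ 0 comes from adding -a to both sides of a + 1 ≋ a.
  next-≢ (s≤s _) a eq = contradiction (residues 1≋0) λ ()
    where
    2ha+1+a≋1 : 2 * h * toℕ a + (1 + toℕ a) ≋ 1
    2ha+1+a≋1 = multiple 1 (toℕ a)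
      (solve 2 (λ h a → con 2 :* h :* a :+ (con 1 :+ a) := con 1 :+ a :* (con 1 :+ con 2 :* h)) refl h (toℕ a))
    2ha+a≋0 : 2 * h * toℕ a + toℕ a ≋ 0
    2ha+a≋0 = multiple 0 (toℕ a)
      (solve 2 (λ h a → con 2 :* h :* a :+ a := a :* (con 1 :+ con 2 :* h)) refl h (toℕ a))
    1+a≋a : 1 + toℕ a ≋ toℕ a
    1+a≋a = congruent (trans (sym (residues (toℕ-mod (1 + toℕ a)))) (cong (λ e → toℕ e % n) (sym eq)))
    1≋0 : 1 ≋ 0
    1≋0 = congruent (sym (residues 2ha+1+a≋1)) ⊙ +-congˡ (2 * h * toℕ a) 1+a≋a ⊙ 2ha+a≋0

-- The midpoint quasigroup of odd order has the transversal {(a , a + 1)}, disjoint from the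
-- diagonal; prolonging along it adjoins one new element, here zero.
module Prolongation (h : ℕ) (1≤h : 1 ≤ h) where
  open Midpoint h

  infixl 7 _⋆_
  _⋆_ : Fin (suc n) → Fin (suc n) → Fin (suc n)
  zero  ⋆ zero  = zero
  -- The value of the transversal cell in column `b` moves to the new row, that of the cell in row
  -- `a` to the new column; the cell itself receives the new element.
  zero  ⋆ suc b = suc (previous b ∙ b)
  suc a ⋆ zero  = suc (a ∙ next a)
  suc a ⋆ suc b with b ≟ next a
  ... | yes _ = zero
  ... | no  _ = suc (a ∙ b)

  ⋆-on : ∀ {a b} → b ≡ next a → suc a ⋆ suc b ≡ zero
  ⋆-on {a} {b} eq with b ≟ next a
  ... | yes _ = refl
  ... | no ≢  = contradiction eq ≢

  ⋆-off : ∀ {a b} → b ≢ next a → suc a ⋆ suc b ≡ suc (a ∙ b)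
  ⋆-off {a} {b} ≢ with b ≟ next a
  ... | yes eq = contradiction eq ≢
  ... | no _   = refl

  previous-≢ : ∀ b → previous b ≢ b
  previous-≢ b eq = next-≢ 1≤h (previous b) (trans eq (sym (next-previous b)))

  ⋆-idem : ∀ a → a ⋆ a ≡ a
  ⋆-idem zero    = refl
  ⋆-idem (suc a) = trans (⋆-off (next-≢ 1≤h a)) (cong suc (∙-idem a))

  ⋆≢ˡ : ∀ {a b} → a ≢ b → a ⋆ b ≢ a
  ⋆≢ˡ {zero}  {zero}  a≢b _ = a≢b refl
  ⋆≢ˡ {zero}  {suc b} _   ()
  ⋆≢ˡ {suc a} {zero}  _   eq = ∙≢ˡ (next-≢ 1≤h a) (suc-injective eq)
  ⋆≢ˡ {suc a} {suc b} a≢b eq with b ≟ next a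
  ⋆≢ˡ {suc a} {suc b} a≢b () | yes _
  ... | no _ = ∙≢ˡ (a≢b ∘ cong suc) (suc-injective eq)

  ⋆≢ʳ : ∀ {a b} → a ≢ b → a ⋆ b ≢ b
  ⋆≢ʳ {zero}  {zero}  a≢b _ = a≢b refl
  ⋆≢ʳ {zero}  {suc b} _   eq = ∙≢ʳ (previous-≢ b) (suc-injective eq)
  ⋆≢ʳ {suc a} {zero}  _   ()
  ⋆≢ʳ {suc a} {suc b} a≢b eq with b ≟ next a
  ⋆≢ʳ {suc a} {suc b} a≢b () | yes _
  ... | no _ = ∙≢ʳ (a≢b ∘ cong suc) (suc-injective eq)

  ⋆-divideˡ : ∀ a c → ∃ λ b → a ⋆ b ≡ c
  ⋆-divideˡ zero    zero    = zero , refl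
  -- The transversal cell with value `c` is (`shift c` , `next (shift c)`), so the new row has `c`
  -- in the column of the second coordinate.
  ⋆-divideˡ zero    (suc c) = suc (next (shift c)) ,
    cong suc (trans (cong (_∙ next (shift c)) (previous-next (shift c))) (shift-midpoint c))
  ⋆-divideˡ (suc a) zero    = suc (next a) , ⋆-on refl
  ⋆-divideˡ (suc a) (suc c) with reflect a c ≟ next a
  -- The old solution lies on the transversal, so its value now stands in the new column.
  ... | yes eq = zero , cong suc (trans (cong (a ∙_) (sym eq)) (∙-reflect a c))
  ... | no ≢   = suc (reflect a c) , trans (⋆-off ≢) (cong suc (∙-reflect a c))

  ⋆-divideʳ : ∀ b c → ∃ λ a → a ⋆ b ≡ c
  ⋆-divideʳ zero    zero    = zero , refl
  ⋆-divideʳ zero    (suc c) = suc (shift c) , cong suc (shift-midpoint c)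
  ⋆-divideʳ (suc b) zero    = suc (previous b) , ⋆-on (sym (next-previous b))
  ⋆-divideʳ (suc b) (suc c) with b ≟ next (reflect b c)
  ... | yes eq = zero , cong suc (trans (∙-comm _ b) (trans
        (cong (b ∙_) (trans (cong previous eq) (previous-next _))) (∙-reflect b c)))
  ... | no ≢   = suc (reflect b c) , trans (⋆-off ≢) (cong suc (trans (∙-comm _ b) (∙-reflect b c)))

  even : IdempotentQuasigroup (suc n)
  even = record
    { _∙_     = _⋆_
    ; idem    = ⋆-idem
    ; ∙≢ˡ     = ⋆≢ˡ
    ; ∙≢ʳ     = ⋆≢ʳ
    ; divideˡ = ⋆-divideˡ
    ; divideʳ = ⋆-divideʳ
    }

halve : ∀ k → ∃ λ h → k ≡ 2 * h ⊎ k ≡ suc (2 * h)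
halve zero = 0 , inj₁ refl
halve (suc k) with halve k
... | h , inj₁ refl = h , inj₂ refl
... | h , inj₂ refl = suc h , inj₁ (solve 1 (λ h → con 2 :+ con 2 :* h := con 2 :* (con 1 :+ h)) refl h)

-- Odd orders are midpoint quasigroups. An even order is prolonged from the odd order below it,
-- which is at least 3, so that the transversal avoids the diagonal.
idempotentQuasigroup : ∀ k → IdempotentQuasigroup (3 + k)
idempotentQuasigroup k with halve k
... | h , inj₁ refl = subst IdempotentQuasigroup
        (solve 1 (λ h → con 1 :+ con 2 :* (con 1 :+ h) := con 3 :+ con 2 :* h) refl h) (Midpoint.odd (suc h))
... | h , inj₂ refl = subst IdempotentQuasigroup
        (solve 1 (λ h → con 2 :+ con 2 :* (con 1 :+ h) := con 4 :+ con 2 :* h) refl h) (Prolongation.even (suc h) (s≤s z≤n))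

-- Arcs between different groups.

infixl 6 _⊕_
_⊕_ : Fin 7 → Fin 7 → Fin 7
a ⊕ t = (toℕ a + toℕ t) mod 7

⊕-cancelʳ : ∀ t a b → a ⊕ t ≡ b ⊕ t → a ≡ b
⊕-cancelʳ = toWitness {a? = all? λ t → all? λ a → all? λ b → (a ⊕ t ≟ b ⊕ t) →-dec (a ≟ b)} _

-- The groups a, b, a ∙ b are numbered 0, 1, 2; the second component is the position in Z₇.
Walk : Set
Walk = Vec (Fin 3 × Fin 7) 7

part : Walk → Fin 7 → Fin 3
part walk j = proj₁ (lookup walk j)

label : Walk → Fin 7 → Fin 7
label walk j = proj₂ (lookup walk j)

-- `differences` says that every pair of labels is a translate of the labels of some arc, that is,
-- the seven differences head minus tail exhaust Z₇. The difference 0 causes no loop because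
-- `proper` sends each arc to another group.
record IsTripartite (as : Arcs) (walk : Walk) : Set where
  field
    walk-injective : ∀ j k → lookup walk j ≡ lookup walk k → j ≡ k
    proper         : ∀ j → part walk (tail as j) ≢ part walk (head as j)
    differences    : ∀ x y → ∃₂ λ j t →
                       label walk (tail as j) ⊕ t ≡ x × label walk (head as j) ⊕ t ≡ y

module Cross {as : Arcs} {walk : Walk} (isTripartite : IsTripartite as walk)
             {l : ℕ} (Q : IdempotentQuasigroup (suc l)) where
  open IsTripartite isTripartite
  open IdempotentQuasigroup Q

  corner : Fin (suc l) × Fin (suc l) → Fin 3 → Fin (suc l)
  corner (a , b) 0F = a
  corner (a , b) 1F = b
  corner (a , b) 2F = a ∙ b

  corner-injective : ∀ {a b} → a ≢ b → ∀ P Q → corner (a , b) P ≡ corner (a , b) Q → P ≡ Q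
  corner-injective a≢b 0F 0F eq = refl
  corner-injective a≢b 0F 1F eq = contradiction eq a≢b
  corner-injective a≢b 0F 2F eq = contradiction (sym eq) (∙≢ˡ a≢b)
  corner-injective a≢b 1F 0F eq = contradiction (sym eq) a≢b
  corner-injective a≢b 1F 1F eq = refl
  corner-injective a≢b 1F 2F eq = contradiction (sym eq) (∙≢ʳ a≢b)
  corner-injective a≢b 2F 0F eq = contradiction eq (∙≢ˡ a≢b)
  corner-injective a≢b 2F 1F eq = contradiction eq (∙≢ʳ a≢b)
  corner-injective a≢b 2F 2F eq = refl

  -- A quasigroup triple (a , b , a ∙ b) is determined by any two of its entries.
  corner-onto : ∀ P Q → P ≢ Q → ∀ {x y} → x ≢ y →
                ∃ λ c → proj₁ c ≢ proj₂ c × corner c P ≡ x × corner c Q ≡ y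
  corner-onto 0F 0F P≢Q = contradiction refl P≢Q
  corner-onto 1F 1F P≢Q = contradiction refl P≢Q
  corner-onto 2F 2F P≢Q = contradiction refl P≢Q
  corner-onto 0F 1F _ {x} {y} x≢y = (x , y) , x≢y , refl , refl
  corner-onto 1F 0F _ {x} {y} x≢y = (y , x) , x≢y ∘ sym , refl , refl
  corner-onto 0F 2F _ {x} {y} x≢y with b , eq ← divideˡ x y =
    -- If the two groups coincided, idempotence would make `x ∙ b` equal to `x`, hence `x ≡ y`.
    (x , b) , (λ { refl → x≢y (trans (sym (idem x)) eq) }) , refl , eq
  corner-onto 2F 0F _ {x} {y} x≢y with b , eq ← divideˡ y x =
    (y , b) , (λ { refl → x≢y (trans (sym eq) (idem y)) }) , eq , refl
  corner-onto 1F 2F _ {x} {y} x≢y with a , eq ← divideʳ x y =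
    (a , x) , (λ { refl → x≢y (trans (sym (idem x)) eq) }) , refl , eq
  corner-onto 2F 1F _ {x} {y} x≢y with a , eq ← divideʳ y x =
    (a , y) , (λ { refl → x≢y (trans (sym eq) (idem y)) }) , eq , refl

  -- An ordered pair of distinct groups, coded as for `punch`, and a translation. This gives 7 l (l
  -- + 1) blocks of seven arcs, matching the 49 l (l + 1) arcs between groups.
  Index : Set
  Index = (Fin (suc l) × Fin l) × Fin 7

  block : Index → Fin 7 → Fin (suc l) × Fin 7
  block (c , t) j = corner (punch c) (part walk j) , label walk j ⊕ t

  block-injective : ∀ i {j k} → block i j ≡ block i k → j ≡ k
  block-injective ((a , d) , t) {j} {k} eq = walk-injective j k (cong₂ _,_
    (corner-injective (punchInᵢ≢i a d ∘ sym) _ _ (cong proj₁ eq))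
    (⊕-cancelʳ t _ _ (cong proj₂ eq)))

  -- The labels `p` and `q` fix the position `j` and the translation `t`; the two parts joined by
  -- arc `j` then fix the pair of groups.
  block-covers : ∀ {x y} → x ≢ y → ∀ p q → ∃₂ λ i j → (block i (tail as j) , block i (head as j)) ≡ ((x , p) , (y , q))
  block-covers x≢y p q
    with j , t , eqₚ , eq_q ← differences p q
    with (a , b) , a≢b , eqₓ , eq_y ← corner-onto _ _ (proper j) x≢y
    = ((a , punchOut a≢b) , t) , j , cong₂ _,_
        (cong₂ _,_ (trans (cong (λ c → corner c (part walk (tail as j))) a,b) eqₓ) eqₚ)
        (cong₂ _,_ (trans (cong (λ c → corner c (part walk (head as j))) a,b) eq_y) eq_q)
    where
    a,b : punch (a , punchOut a≢b) ≡ (a , b)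
    a,b = cong (a ,_) (punchIn-punchOut a≢b)

-- Filling the groups.

module _ {as : Arcs} {walk : Walk} (isTripartite : IsTripartite as walk) {l : ℕ} (Q : IdempotentQuasigroup (suc l)) where
  open Cross isTripartite Q

  fill₀ : ∀ {r} → Covering as (Fin r) (Fin 7) →
          Covering as ((Fin (suc l) × Fin r) ⊎ Index) (Fin (suc l) × Fin 7)
  fill₀ {r} H = record { block = block₀ ; injective = injective₀ ; covers = covers₀ _ _ }
    where
    module H = Covering H
    block₀ : (Fin (suc l) × Fin r) ⊎ Index → Fin 7 → Fin (suc l) × Fin 7
    block₀ (inj₁ (a , i)) j = a , H.block i j
    block₀ (inj₂ i)       j = block i j
    injective₀ : ∀ i {j k} → block₀ i j ≡ block₀ i k → j ≡ k
    injective₀ (inj₁ (a , i)) eq = H.injective i (cong proj₂ eq)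
    injective₀ (inj₂ i)       eq = block-injective i eq
    covers₀ : ∀ x y → x ≢ y → ∃₂ λ i j → (block₀ i (tail as j) , block₀ i (head as j)) ≡ (x , y)
    covers₀ (a , p) (b , q) x≢y with a ≟ b
    ... | yes refl with i , j , eq ← H.covers (x≢y ∘ cong (a ,_)) =
          inj₁ (a , i) , j , cong (λ (p , q) → (a , p) , (a , q)) eq
    ... | no a≢b with i , j , eq ← block-covers a≢b p q = inj₂ i , j , eq

  fill₁ : ∀ {r} → Covering as (Fin r) (Fin 8) →
          Covering as ((Fin (suc l) × Fin r) ⊎ Index) (Fin 1 ⊎ (Fin (suc l) × Fin 7))
  fill₁ {r} H = record { block = block₁ ; injective = injective₁ ; covers = covers₁ _ _ }
    where
    module H = Covering H
    embed : Fin (suc l) → Fin 8 → Fin 1 ⊎ (Fin (suc l) × Fin 7)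
    -- The point `zero` of every copy of the complete digraph of order 8 is the same extra point;
    -- the copies are otherwise disjoint.
    embed a zero    = inj₁ zero
    embed a (suc p) = inj₂ (a , p)
    embed-injective : ∀ a p q → embed a p ≡ embed a q → p ≡ q
    embed-injective a zero    zero    eq   = refl
    embed-injective a (suc p) (suc q) refl = refl
    block₁ : (Fin (suc l) × Fin r) ⊎ Index → Fin 7 → Fin 1 ⊎ (Fin (suc l) × Fin 7)
    block₁ (inj₁ (a , i)) j = embed a (H.block i j)
    block₁ (inj₂ i)       j = inj₂ (block i j)
    injective₁ : ∀ i {j k} → block₁ i j ≡ block₁ i k → j ≡ k
    injective₁ (inj₁ (a , i)) eq = H.injective i (embed-injective a _ _ eq)
    injective₁ (inj₂ i)       eq = block-injective i (inj₂-injective eq)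
    within : ∀ a {p q} → embed a p ≢ embed a q →
             ∃₂ λ i j → (block₁ i (tail as j) , block₁ i (head as j)) ≡ (embed a p , embed a q)
    within a p≢q with i , j , eq ← H.covers (p≢q ∘ cong (embed a)) =
      inj₁ (a , i) , j , cong (λ (p , q) → embed a p , embed a q) eq
    covers₁ : ∀ x y → x ≢ y → ∃₂ λ i j → (block₁ i (tail as j) , block₁ i (head as j)) ≡ (x , y)
    covers₁ (inj₁ zero)    (inj₁ zero)    x≢y = contradiction refl x≢y
    covers₁ (inj₁ zero)    (inj₂ (b , q)) x≢y = within b {zero} {suc q} x≢y
    covers₁ (inj₂ (a , p)) (inj₁ zero)    x≢y = within a {suc p} {zero} x≢y
    covers₁ (inj₂ (a , p)) (inj₂ (b , q)) x≢y with a ≟ b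
    ... | yes refl = within a {suc p} {suc q} x≢y
    ... | no a≢b with i , j , eq ← block-covers a≢b p q =
          inj₂ i , j , cong (λ (x , y) → inj₂ x , inj₂ y) eq

-- Both directions for one orientation, from finite data.

-- The block numbers are v (v - 1) / 7. Orders 14 and 15 are given separately because no idempotent
-- quasigroup of order 2 exists.
record Ingredients (as : Arcs) : Set where
  field
    loopless       : Loopless as
    arcs-injective : ∀ j k → lookup as j ≡ lookup as k → j ≡ k
    {walk}         : Walk
    isTripartite   : IsTripartite as walk
    K*₇            : Covering as (Fin 6) (Fin 7)
    K*₈            : Covering as (Fin 8) (Fin 8)
    K*₁₄           : Covering as (Fin 26) (Fin 14)
    K*₁₅           : Covering as (Fin 30) (Fin 15)

module _ {as : Arcs} (given : Ingredients as) where
  open Ingredients given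

  private
    index↔ : ∀ l r → ((Fin (suc l) × Fin r) ⊎ ((Fin (suc l) × Fin l) × Fin 7)) ↔ Fin (suc l * r + suc l * l * 7)
    index↔ l r = ↔-sym (↔-trans +↔⊎ (*↔× ⊎-↔ ↔-trans *↔× (*↔× ×-↔ ↔-refl)))

  decompose₀ : ∀ k → Decomposition ⟦ as ⟧ (K* (suc k * 7))
  decompose₀ 0 = decomposition loopless K*₇ ≤-refl
  decompose₀ 1 = decomposition loopless K*₁₄ ≤-refl
  decompose₀ (suc (suc k)) = decomposition loopless
    (relabel (index↔ (2 + k) 6) (↔-sym *↔×) (fill₀ isTripartite (idempotentQuasigroup k) K*₇))
    -- With 3 + k groups, the blocks inside and between groups together have exactly v (v - 1) arcs.
    (≤-reflexive (solve 1 (λ k → ((con 3 :+ k) :* con 6 :+ (con 3 :+ k) :* (con 2 :+ k) :* con 7) :* con 7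
      := ((con 3 :+ k) :* con 7) :* (con 6 :+ (con 2 :+ k) :* con 7)) refl k))

  decompose₁ : ∀ k → Decomposition ⟦ as ⟧ (K* (1 + suc k * 7))
  decompose₁ 0 = decomposition loopless K*₈ ≤-refl
  decompose₁ 1 = decomposition loopless K*₁₅ ≤-refl
  decompose₁ (suc (suc k)) = decomposition loopless
    (relabel (index↔ (2 + k) 8) (↔-sym (↔-trans +↔⊎ (↔-refl ⊎-↔ *↔×))) (fill₁ isTripartite (idempotentQuasigroup k) K*₈))
    (≤-reflexive (solve 1 (λ k → ((con 3 :+ k) :* con 8 :+ (con 3 :+ k) :* (con 2 :+ k) :* con 7) :* con 7
      := (con 1 :+ (con 3 :+ k) :* con 7) :* ((con 3 :+ k) :* con 7)) refl k))

  sufficiency : ∀ v → 7 ≤ v → v % 7 ≡ 0 ⊎ v % 7 ≡ 1 → Decomposition ⟦ as ⟧ (K* v)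
  sufficiency v 7≤v residue with v / 7 | m≡m%n+[m/n]*n v 7
  sufficiency v 7≤v residue      | zero  | eq = contradiction (≤-trans 7≤v (≤-reflexive (trans eq (+-identityʳ _)))) (<⇒≱ (m%n<n v 7))
  sufficiency v 7≤v (inj₁ v%7≡0) | suc k | eq = subst (Decomposition ⟦ as ⟧ ∘ K*) (sym (trans eq (cong (_+ suc k * 7) v%7≡0))) (decompose₀ k)
  sufficiency v 7≤v (inj₂ v%7≡1) | suc k | eq = subst (Decomposition ⟦ as ⟧ ∘ K*) (sym (trans eq (cong (_+ suc k * 7) v%7≡1))) (decompose₁ k)

  necessity : ∀ v → 7 ≤ v → Decomposition ⟦ as ⟧ (K* v) → v % 7 ≡ 0 ⊎ v % 7 ≡ 1
  necessity (suc w) _ X with euclidsLemma (suc w) w (toWitness {a? = prime? 7} _)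
      (divides (Decomposition.size X) (sym (arc-count (arcs-injective _ _) X)))
  ... | inj₁ 7∣v = inj₁ (n∣m⇒m%n≡0 (suc w) 7 7∣v)
  ... | inj₂ (divides q refl) = inj₂ ([m+kn]%n≡m%n 1 q 7)

-- The ten orientations

lookup-injective? : ∀ {m n} (vs : Vec (Fin m × Fin n) 7) → Dec (∀ j k → lookup vs j ≡ lookup vs k → j ≡ k)
lookup-injective? vs = all? λ j → all? λ k → ≡-dec _≟_ _≟_ (lookup vs j) (lookup vs k) →-dec (j ≟ k)

loopless? : ∀ as → Dec (Loopless as)
loopless? as = all? λ j → ¬? (tail as j ≟ head as j)

proper? : ∀ as walk → Dec (∀ j → part walk (tail as j) ≢ part walk (head as j))
proper? as walk = all? λ j → ¬? (part walk (tail as j) ≟ part walk (head as j))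

differences? : ∀ as walk → Dec (∀ x y → ∃₂ λ j t →
  label walk (tail as j) ⊕ t ≡ x × label walk (head as j) ⊕ t ≡ y)
differences? as walk = all? λ x → all? λ y → any? λ j → any? λ t →
  (label walk (tail as j) ⊕ t ≟ x) ×-dec (label walk (head as j) ⊕ t ≟ y)

Table : ℕ → Set
Table = Vec (Vec ℕ 7)

-- Points from n on are fixed; they play the role of ∞.
develop : ∀ {r} n .{{_ : NonZero n}} → (step count : ℕ) → Table r → Table (count * r)
develop n step count starters = concat (tabulate {n = count} λ t → map (map (translate (toℕ t))) starters)
  where
  translate : ℕ → ℕ → ℕ
  translate t x = if x <ᵇ n then (x + t * step) % n else x

-- All table entries used are below `v`, so the reduction only changes their type.
point : ∀ {m} v .{{_ : NonZero v}} → Table m → Fin m → Fin 7 → Fin v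
point v table i j = lookup (lookup table i) j mod v

module _ (as : Arcs) {m} (v : ℕ) .{{_ : NonZero v}} (table : Table m) where
  private
    Covers : Set
    Covers = (∀ i j k → point v table i j ≡ point v table i k → j ≡ k) ×
             (∀ x y → x ≡ y ⊎ ∃₂ λ i j → (point v table i (tail as j) , point v table i (head as j)) ≡ (x , y))

  covers? : Dec Covers
  covers? =
    (all? λ i → all? λ j → all? λ k → (point v table i j ≟ point v table i k) →-dec (j ≟ k)) ×-dec
    (all? λ x → all? λ y → (x ≟ y) ⊎-dec (any? λ i → any? λ j →
      ≡-dec _≟_ _≟_ (point v table i (tail as j) , point v table i (head as j)) (x , y)))

  covering : Covers → Covering as (Fin m) (Fin v)
  covering (distinct , covered) = record
    { block     = point v table
    ; injective = λ i → distinct i _ _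
    ; covers    = λ {x} {y} x≢y → [ (λ x≡y → contradiction x≡y x≢y) , id ]′ (covered x y)
    }

-- Each `True` argument reduces to the unit type once its decision evaluates to yes, and is then
-- inferred; the listed data are thereby checked by computation.
ingredients! : ∀ {as} (walk : Walk) (t₇ : Table 6) (t₈ : Table 8) (t₁₄ : Table 26) (t₁₅ : Table 30)
  {_ : True (loopless? as)} {_ : True (lookup-injective? as)}
  {_ : True (lookup-injective? walk)} {_ : True (proper? as walk)} {_ : True (differences? as walk)}
  {_ : True (covers? as 7 t₇)} {_ : True (covers? as 8 t₈)}
  {_ : True (covers? as 14 t₁₄)} {_ : True (covers? as 15 t₁₅)} →
  Ingredients as
ingredients! {as} walk t₇ t₈ t₁₄ t₁₅ {l} {a} {w} {p} {d} {c₇} {c₈} {c₁₄} {c₁₅} = record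
  { loopless       = toWitness l
  ; arcs-injective = toWitness a
  ; walk           = walk
  ; isTripartite   = record
    { walk-injective = toWitness w
    ; proper         = toWitness p
    ; differences    = toWitness d
    }
  ; K*₇            = covering as 7 t₇ (toWitness c₇)
  ; K*₈            = covering as 8 t₈ (toWitness c₈)
  ; K*₁₄           = covering as 14 t₁₄ (toWitness c₁₄)
  ; K*₁₅           = covering as 15 t₁₅ (toWitness c₁₅)
  }

-- Here and in the next eight cases the starters live on Z₆ with a fixed point, Z₈, Z₁₃ with a fixed
-- point, and Z₁₅. Together the starters of one order realise each nonzero difference once, and one
-- arc to and one from the fixed point if there is one.
ingredients₁ : Ingredients ((1F , 0F) ∷ (1F , 2F) ∷ (2F , 3F) ∷ (3F , 4F) ∷ (4F , 5F) ∷ (5F , 6F) ∷ (6F , 0F) ∷ [])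
ingredients₁ = ingredients!
  -- A closed walk alternating between two groups has even length, so each walk visits the third
  -- group, and does so once.
  ((0F , 0F) ∷ (1F , 0F) ∷ (0F , 1F) ∷ (1F , 3F) ∷ (0F , 2F) ∷ (1F , 5F) ∷ (2F , 2F) ∷ [])
  (develop 6 1 6 ((0 ∷ 1 ∷ 6 ∷ 2 ∷ 5 ∷ 3 ∷ 4 ∷ []) ∷ []))
  (develop 8 1 8 ((0 ∷ 2 ∷ 7 ∷ 6 ∷ 1 ∷ 3 ∷ 4 ∷ []) ∷ []))
  (develop 13 1 13 ((0 ∷ 3 ∷ 13 ∷ 8 ∷ 6 ∷ 12 ∷ 4 ∷ []) ∷
                    (0 ∷ 1 ∷ 3 ∷ 10 ∷ 5 ∷ 8 ∷ 9 ∷ []) ∷ []))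
  (develop 15 1 15 ((0 ∷ 10 ∷ 7 ∷ 6 ∷ 4 ∷ 13 ∷ 9 ∷ []) ∷
                    (0 ∷ 5 ∷ 7 ∷ 11 ∷ 3 ∷ 4 ∷ 12 ∷ []) ∷ []))

ingredients₂ : Ingredients ((1F , 0F) ∷ (2F , 1F) ∷ (2F , 3F) ∷ (3F , 4F) ∷ (4F , 5F) ∷ (5F , 6F) ∷ (6F , 0F) ∷ [])
ingredients₂ = ingredients!
  ((0F , 0F) ∷ (1F , 1F) ∷ (2F , 0F) ∷ (0F , 2F) ∷ (1F , 0F) ∷ (0F , 3F) ∷ (1F , 3F) ∷ [])
  (develop 6 1 6 ((0 ∷ 1 ∷ 4 ∷ 2 ∷ 3 ∷ 5 ∷ 6 ∷ []) ∷ []))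
  (develop 8 1 8 ((0 ∷ 2 ∷ 6 ∷ 7 ∷ 4 ∷ 3 ∷ 5 ∷ []) ∷ []))
  (develop 13 1 13 ((0 ∷ 10 ∷ 4 ∷ 8 ∷ 9 ∷ 3 ∷ 1 ∷ []) ∷
                    (0 ∷ 8 ∷ 11 ∷ 13 ∷ 7 ∷ 2 ∷ 4 ∷ []) ∷ []))
  (develop 15 1 15 ((0 ∷ 6 ∷ 10 ∷ 14 ∷ 2 ∷ 8 ∷ 3 ∷ []) ∷
                    (0 ∷ 7 ∷ 5 ∷ 3 ∷ 4 ∷ 11 ∷ 1 ∷ []) ∷ []))

ingredients₃ : Ingredients ((1F , 0F) ∷ (1F , 2F) ∷ (3F , 2F) ∷ (3F , 4F) ∷ (4F , 5F) ∷ (5F , 6F) ∷ (6F , 0F) ∷ [])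
ingredients₃ = ingredients!
  ((0F , 0F) ∷ (1F , 1F) ∷ (0F , 1F) ∷ (1F , 0F) ∷ (0F , 2F) ∷ (1F , 5F) ∷ (2F , 2F) ∷ [])
  (develop 6 1 6 ((0 ∷ 5 ∷ 1 ∷ 4 ∷ 3 ∷ 6 ∷ 2 ∷ []) ∷ []))
  (develop 8 1 8 ((0 ∷ 3 ∷ 5 ∷ 4 ∷ 2 ∷ 6 ∷ 1 ∷ []) ∷ []))
  (develop 13 1 13 ((0 ∷ 1 ∷ 10 ∷ 8 ∷ 2 ∷ 6 ∷ 13 ∷ []) ∷
                    (0 ∷ 12 ∷ 5 ∷ 10 ∷ 8 ∷ 11 ∷ 3 ∷ []) ∷ []))
  (develop 15 1 15 ((0 ∷ 8 ∷ 3 ∷ 12 ∷ 10 ∷ 9 ∷ 11 ∷ []) ∷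
                    (0 ∷ 7 ∷ 8 ∷ 14 ∷ 10 ∷ 13 ∷ 3 ∷ []) ∷ []))

ingredients₄ : Ingredients ((1F , 0F) ∷ (1F , 2F) ∷ (2F , 3F) ∷ (4F , 3F) ∷ (4F , 5F) ∷ (5F , 6F) ∷ (6F , 0F) ∷ [])
ingredients₄ = ingredients!
  ((0F , 0F) ∷ (1F , 1F) ∷ (0F , 1F) ∷ (1F , 3F) ∷ (0F , 2F) ∷ (1F , 0F) ∷ (2F , 3F) ∷ [])
  (develop 6 1 6 ((0 ∷ 5 ∷ 6 ∷ 4 ∷ 1 ∷ 3 ∷ 2 ∷ []) ∷ []))
  (develop 8 1 8 ((0 ∷ 6 ∷ 3 ∷ 1 ∷ 5 ∷ 4 ∷ 7 ∷ []) ∷ []))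
  (develop 13 1 13 ((0 ∷ 5 ∷ 11 ∷ 8 ∷ 3 ∷ 2 ∷ 9 ∷ []) ∷
                    (0 ∷ 2 ∷ 13 ∷ 3 ∷ 7 ∷ 8 ∷ 10 ∷ []) ∷ []))
  (develop 15 1 15 ((0 ∷ 2 ∷ 12 ∷ 9 ∷ 7 ∷ 10 ∷ 14 ∷ []) ∷
                    (0 ∷ 6 ∷ 11 ∷ 10 ∷ 4 ∷ 12 ∷ 8 ∷ []) ∷ []))

ingredients₅ : Ingredients ((1F , 0F) ∷ (2F , 1F) ∷ (3F , 2F) ∷ (3F , 4F) ∷ (4F , 5F) ∷ (5F , 6F) ∷ (6F , 0F) ∷ [])
ingredients₅ = ingredients!
  ((0F , 0F) ∷ (1F , 1F) ∷ (0F , 1F) ∷ (1F , 0F) ∷ (0F , 2F) ∷ (1F , 5F) ∷ (2F , 2F) ∷ [])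
  (develop 6 1 6 ((0 ∷ 1 ∷ 3 ∷ 2 ∷ 5 ∷ 6 ∷ 4 ∷ []) ∷ []))
  (develop 8 1 8 ((0 ∷ 4 ∷ 7 ∷ 6 ∷ 1 ∷ 3 ∷ 2 ∷ []) ∷ []))
  (develop 13 1 13 ((0 ∷ 1 ∷ 4 ∷ 10 ∷ 3 ∷ 11 ∷ 2 ∷ []) ∷
                    (0 ∷ 13 ∷ 10 ∷ 8 ∷ 4 ∷ 9 ∷ 12 ∷ []) ∷ []))
  (develop 15 1 15 ((0 ∷ 3 ∷ 4 ∷ 11 ∷ 14 ∷ 6 ∷ 2 ∷ []) ∷
                    (0 ∷ 11 ∷ 5 ∷ 4 ∷ 14 ∷ 1 ∷ 10 ∷ []) ∷ []))

ingredients₆ : Ingredients ((1F , 0F) ∷ (2F , 1F) ∷ (2F , 3F) ∷ (3F , 4F) ∷ (5F , 4F) ∷ (5F , 6F) ∷ (6F , 0F) ∷ [])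
ingredients₆ = ingredients!
  ((0F , 0F) ∷ (1F , 0F) ∷ (0F , 1F) ∷ (1F , 3F) ∷ (0F , 6F) ∷ (1F , 5F) ∷ (2F , 2F) ∷ [])
  (develop 6 1 6 ((0 ∷ 2 ∷ 3 ∷ 4 ∷ 1 ∷ 5 ∷ 6 ∷ []) ∷ []))
  (develop 8 1 8 ((0 ∷ 5 ∷ 3 ∷ 7 ∷ 6 ∷ 1 ∷ 2 ∷ []) ∷ []))
  (develop 13 1 13 ((0 ∷ 2 ∷ 12 ∷ 3 ∷ 4 ∷ 8 ∷ 1 ∷ []) ∷
                    (0 ∷ 13 ∷ 4 ∷ 12 ∷ 6 ∷ 1 ∷ 11 ∷ []) ∷ []))
  (develop 15 1 15 ((0 ∷ 7 ∷ 8 ∷ 4 ∷ 6 ∷ 3 ∷ 10 ∷ []) ∷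
                    (0 ∷ 9 ∷ 5 ∷ 6 ∷ 3 ∷ 8 ∷ 2 ∷ []) ∷ []))

ingredients₇ : Ingredients ((1F , 0F) ∷ (1F , 2F) ∷ (3F , 2F) ∷ (3F , 4F) ∷ (4F , 5F) ∷ (6F , 5F) ∷ (6F , 0F) ∷ [])
ingredients₇ = ingredients!
  ((0F , 0F) ∷ (1F , 0F) ∷ (0F , 1F) ∷ (1F , 3F) ∷ (0F , 2F) ∷ (1F , 5F) ∷ (2F , 3F) ∷ [])
  (develop 6 1 6 ((0 ∷ 1 ∷ 2 ∷ 4 ∷ 6 ∷ 5 ∷ 3 ∷ []) ∷ []))
  (develop 8 1 8 ((0 ∷ 6 ∷ 1 ∷ 2 ∷ 7 ∷ 5 ∷ 4 ∷ []) ∷ []))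
  (develop 13 1 13 ((0 ∷ 4 ∷ 1 ∷ 3 ∷ 8 ∷ 7 ∷ 5 ∷ []) ∷
                    (0 ∷ 9 ∷ 3 ∷ 10 ∷ 13 ∷ 2 ∷ 12 ∷ []) ∷ []))
  (develop 15 1 15 ((0 ∷ 8 ∷ 9 ∷ 6 ∷ 1 ∷ 12 ∷ 13 ∷ []) ∷
                    (0 ∷ 7 ∷ 4 ∷ 10 ∷ 8 ∷ 13 ∷ 9 ∷ []) ∷ []))

ingredients₈ : Ingredients ((1F , 0F) ∷ (2F , 1F) ∷ (2F , 3F) ∷ (4F , 3F) ∷ (4F , 5F) ∷ (5F , 6F) ∷ (6F , 0F) ∷ [])
ingredients₈ = ingredients!
  ((0F , 0F) ∷ (1F , 0F) ∷ (0F , 1F) ∷ (1F , 3F) ∷ (0F , 2F) ∷ (1F , 5F) ∷ (2F , 2F) ∷ [])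
  (develop 6 1 6 ((0 ∷ 1 ∷ 3 ∷ 4 ∷ 2 ∷ 5 ∷ 6 ∷ []) ∷ []))
  (develop 8 1 8 ((0 ∷ 1 ∷ 7 ∷ 3 ∷ 6 ∷ 4 ∷ 5 ∷ []) ∷ []))
  (develop 13 1 13 ((0 ∷ 12 ∷ 9 ∷ 1 ∷ 4 ∷ 2 ∷ 13 ∷ []) ∷
                    (0 ∷ 6 ∷ 11 ∷ 10 ∷ 1 ∷ 3 ∷ 9 ∷ []) ∷ []))
  (develop 15 1 15 ((0 ∷ 1 ∷ 11 ∷ 14 ∷ 5 ∷ 13 ∷ 2 ∷ []) ∷
                    (0 ∷ 14 ∷ 4 ∷ 1 ∷ 10 ∷ 12 ∷ 8 ∷ []) ∷ []))

ingredients₉ : Ingredients ((1F , 0F) ∷ (2F , 1F) ∷ (2F , 3F) ∷ (3F , 4F) ∷ (4F , 5F) ∷ (6F , 5F) ∷ (6F , 0F) ∷ [])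
ingredients₉ = ingredients!
  ((0F , 0F) ∷ (1F , 0F) ∷ (0F , 1F) ∷ (1F , 3F) ∷ (0F , 6F) ∷ (1F , 4F) ∷ (2F , 3F) ∷ [])
  (develop 6 1 6 ((0 ∷ 2 ∷ 3 ∷ 6 ∷ 4 ∷ 1 ∷ 5 ∷ []) ∷ []))
  (develop 8 1 8 ((0 ∷ 1 ∷ 6 ∷ 4 ∷ 5 ∷ 7 ∷ 3 ∷ []) ∷ []))
  (develop 13 1 13 ((0 ∷ 9 ∷ 2 ∷ 10 ∷ 7 ∷ 12 ∷ 1 ∷ []) ∷
                    (0 ∷ 4 ∷ 3 ∷ 6 ∷ 13 ∷ 9 ∷ 7 ∷ []) ∷ []))
  (develop 15 1 15 ((0 ∷ 5 ∷ 11 ∷ 8 ∷ 6 ∷ 9 ∷ 4 ∷ []) ∷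
                    (0 ∷ 9 ∷ 10 ∷ 3 ∷ 5 ∷ 12 ∷ 11 ∷ []) ∷ []))

ingredients₁₀ : Ingredients ((0F , 1F) ∷ (1F , 2F) ∷ (2F , 3F) ∷ (3F , 4F) ∷ (4F , 5F) ∷ (5F , 6F) ∷ (6F , 0F) ∷ [])
ingredients₁₀ = ingredients!
  ((0F , 0F) ∷ (1F , 0F) ∷ (0F , 1F) ∷ (1F , 3F) ∷ (0F , 2F) ∷ (1F , 5F) ∷ (2F , 2F) ∷ [])
  -- The differences around a directed cycle sum to 0. But 1 + … + 7 = 28 is not 0 mod 8, and modulo 13 a
  -- starter avoiding the fixed point would force the other one to close up early; hence the smaller
  -- groups of order 4 and 7. The last five blocks of K*₁₄ are fixed by the latter.
  (develop 6 1 6 ((6 ∷ 5 ∷ 3 ∷ 4 ∷ 1 ∷ 0 ∷ 2 ∷ []) ∷ []))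
  (develop 8 2 4 ((0 ∷ 3 ∷ 2 ∷ 1 ∷ 7 ∷ 4 ∷ 5 ∷ []) ∷
                  (1 ∷ 5 ∷ 6 ∷ 4 ∷ 0 ∷ 2 ∷ 7 ∷ []) ∷ []))
  (develop 14 2 7 ((1 ∷ 4 ∷ 3 ∷ 10 ∷ 6 ∷ 12 ∷ 9 ∷ []) ∷
                   (0 ∷ 5 ∷ 4 ∷ 7 ∷ 2 ∷ 9 ∷ 13 ∷ []) ∷
                   (0 ∷ 1 ∷ 12 ∷ 7 ∷ 3 ∷ 8 ∷ 10 ∷ []) ∷ []) ++
   ((1 ∷ 13 ∷ 11 ∷ 9 ∷ 7 ∷ 5 ∷ 3 ∷ []) ∷
    (1 ∷ 9 ∷ 3 ∷ 11 ∷ 5 ∷ 13 ∷ 7 ∷ []) ∷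
    (0 ∷ 12 ∷ 10 ∷ 8 ∷ 6 ∷ 4 ∷ 2 ∷ []) ∷
    (1 ∷ 3 ∷ 5 ∷ 7 ∷ 9 ∷ 11 ∷ 13 ∷ []) ∷
    (0 ∷ 8 ∷ 2 ∷ 10 ∷ 4 ∷ 12 ∷ 6 ∷ []) ∷ []))
  (develop 15 1 15 ((0 ∷ 5 ∷ 7 ∷ 4 ∷ 2 ∷ 10 ∷ 14 ∷ []) ∷
                    (0 ∷ 9 ∷ 5 ∷ 12 ∷ 7 ∷ 10 ∷ 1 ∷ []) ∷ []))

ingredients : All (λ E → ∃ λ as → E ≡ ⟦ as ⟧ × Ingredients as) orientations
ingredients =
  (_ , refl , ingredients₁) ∷
  (_ , refl , ingredients₂) ∷
  (_ , refl , ingredients₃) ∷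
  (_ , refl , ingredients₄) ∷
  (_ , refl , ingredients₅) ∷
  (_ , refl , ingredients₆) ∷
  (_ , refl , ingredients₇) ∷
  (_ , refl , ingredients₈) ∷
  (_ , refl , ingredients₉) ∷
  (_ , refl , ingredients₁₀) ∷ []

theorem3p7 : (D : Digraph) → IsOrientationOf7Cycle D → (v : ℕ) → 7 ≤ v →
    Decomposition D (K* v) ⇔ (v % 7 ≡ 0 ⊎ v % 7 ≡ 1)
theorem3p7 D oriented v 7≤v with (as , eq , given) , D≅E ← lookupAny ingredients oriented = mk⇔
  (necessity given v 7≤v ∘ Decomposition-resp-≅ D≅as)
  (Decomposition-resp-≅ (≅-sym D≅as) ∘ sufficiency given v 7≤v)
  where
  D≅as : D ≅ ⟦ as ⟧
  D≅as = subst (D ≅_) eq D≅E
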